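{- Every digraph $G$ has a majority $4$-colouring; that is, there is a function $f:V(G)\to\{1,2,3,4\}$ such that for every vertex $v\in V(G)$, at most half of the out-neighbours $w$ of $v$ satisfy $f(w)=f(v)$.
   Context: Digraphs are finite, with no loops and no parallel arcs (a pair of oppositely directed arcs $uv$ and $vu$ is allowed). A majority colouring of a digraph is a function that assigns each vertex a colour such that, for each vertex $v$, at most half the out-neighbours of $v$ receive the same colour as $v$ (a vertex with no out-neighbours satisfies this trivially). A majority $c$-colouring is a majority colouring using at most $c$ colours. -}

module Defs where

open import Data.Fin.Base using (Fin)
open import Data.Fin.Properties using (_≟_)
open import Data.List.Base using (List; allFin; filter; length)
open import Data.Nat.Base using (ℕ; _*_; _≤_)
open import Level using (0ℓ)
open import Relation.Binary.Core using (Rel)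
open import Relation.Binary.Definitions using (Decidable; Irreflexive)
open import Relation.Binary.PropositionalEquality.Core using (_≡_)

-- Arcs form a binary relation, so there are no parallel arcs; decidability
-- makes the number of out-neighbours a computable natural number.
record Digraph (n : ℕ) : Set₁ where
  field
    Arc      : Rel (Fin n) 0ℓ
    arc?     : Decidable Arc
    loopless : Irreflexive _≡_ Arc

  outNeighbours : Fin n → List (Fin n)
  outNeighbours v = filter (arc? v) (allFin n)

open Digraph public

Colouring : ℕ → ℕ → Set
Colouring n c = Fin n → Fin c

sameColourOutNeighbours : ∀ {n c} → Digraph n → Colouring n c → Fin n → List (Fin n)
sameColourOutNeighbours G f v = filter (λ w → f w ≟ f v) (outNeighbours G v)

-- “At most half” is stated without division.
IsMajorityColouring : ∀ {n c} → Digraph n → Colouring n c → Set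
IsMajorityColouring G f =
  ∀ v → 2 * length (sameColourOutNeighbours G f v) ≤ length (outNeighbours G v)

{-# OPTIONS --safe #-}
-- Order the vertices and split the arcs into those going down and those going
-- up. Both halves are acyclic, so well-founded recursion gives each a majority
-- 2-colouring: every vertex takes the colour less frequent among its already
-- coloured out-neighbours. In the product of the two colourings, a vertex
-- shares its colour with at most half of its out-neighbours in either half.
module Submission where

open import Defs
open import Data.Bool.Base using (true; false)
open import Data.Fin.Base using (Fin; zero; suc; combine; _<_; _>_)
open import Data.Fin.Induction using (<-wellFounded; >-wellFounded)
open import Data.Fin.Properties
  using (_≟_; _<?_; ≤∧≢⇒<; combine-injectiveˡ; combine-injectiveʳ)
open import Data.List.Base using (List; []; _∷_; allFin; filter; length; map)
open import Data.List.Properties using (length-map)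
open import Data.List.Relation.Unary.All as All using (All; []; _∷_)
open import Data.List.Relation.Unary.All.Properties using (all-filter; filter⁺)
open import Data.Nat.Base using (ℕ; suc; _+_; _*_; _≤_; z≤n; s≤s)
open import Data.Nat.Properties
  using (≤-total; +-comm; +-suc; +-identityʳ; +-monoʳ-≤; +-mono-≤; *-monoʳ-≤; *-distribˡ-+;
         m≤n⇒m≤1+n; ≮⇒≥; module ≤-Reasoning)
open import Data.Product.Base using (Σ; _,_; proj₁; proj₂)
open import Data.Sum.Base using (inj₁; inj₂)
open import Function.Base using (_∘_)
open import Induction.WellFounded using (WellFounded; WfRec; module All; module FixPoint)
open import Level using (Level; 0ℓ)
open import Relation.Binary.Core using (Rel)
open import Relation.Binary.PropositionalEquality
  using (_≡_; refl; sym; trans; cong; cong₂; subst)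
open import Relation.Nullary using (yes; no; does; contradiction)
open import Relation.Unary using (Pred; Decidable; _⊆_)
open import Relation.Unary.Properties using (∁?)

private
  variable
    a p q r s : Level
    A B : Set a

length-filter-map : {P : Pred B p} (P? : Decidable P) (f : A → B) (xs : List A) →
                    length (filter P? (map f xs)) ≡ length (filter (P? ∘ f) xs)
length-filter-map P? f []       = refl
length-filter-map P? f (x ∷ xs) with ih ← length-filter-map P? f xs | does (P? (f x))
... | true  = cong suc ih
... | false = ih

length-filter-∁ : {P : Pred A p} (P? : Decidable P) (xs : List A) →
                  length (filter P? xs) + length (filter (∁? P?) xs) ≡ length xs
length-filter-∁ P? []       = refl
length-filter-∁ P? (x ∷ xs) with ih ← length-filter-∁ P? xs | does (P? x)
... | true  = cong suc ih
... | false = trans (+-suc _ _) (cong suc ih)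

-- Each element lies on exactly one side of `Q?`, and one counted by `P?` is counted again there, by
-- `R?` or by `S?`. It will be used with `P` agreement of product colours, `R` and `S` agreement in
-- one coordinate, and `Q` the direction of the arc.
length-filter-split : {P : Pred A p} {Q : Pred A q} {R : Pred A r} {S : Pred A s}
                      (P? : Decidable P) (Q? : Decidable Q) (R? : Decidable R) (S? : Decidable S) →
                      P ⊆ R → P ⊆ S → (xs : List A) →
                      length (filter P? xs) ≤
                      length (filter R? (filter Q? xs)) + length (filter S? (filter (∁? Q?) xs))
length-filter-split P? Q? R? S? P⊆R P⊆S = go
  where
  go : ∀ xs → length (filter P? xs) ≤
              length (filter R? (filter Q? xs)) + length (filter S? (filter (∁? Q?) xs))
  go []       = z≤n
  go (x ∷ xs) with ih ← go xs | does (Q? x)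
  go (x ∷ xs) | true with P? x | R? x
  ... | yes px | yes _  = s≤s ih
  ... | yes px | no ¬rx = contradiction (P⊆R px) ¬rx
  ... | no _   | yes _  = m≤n⇒m≤1+n ih
  ... | no _   | no _   = ih
  go (x ∷ xs) | false with P? x | S? x
  ... | yes px | yes _  rewrite +-suc (length (filter R? (filter Q? xs)))
                                      (length (filter S? (filter (∁? Q?) xs))) = s≤s ih
  ... | yes px | no ¬sx = contradiction (P⊆S px) ¬sx
  ... | no _   | yes _  rewrite +-suc (length (filter R? (filter Q? xs)))
                                      (length (filter S? (filter (∁? Q?) xs))) = m≤n⇒m≤1+n ih
  ... | no _   | no _   = ih

m+n≡o∧m≤n⇒2m≤o : ∀ {m n o} → m + n ≡ o → m ≤ n → 2 * m ≤ o
m+n≡o∧m≤n⇒2m≤o {m} {n} refl m≤n rewrite +-identityʳ m = +-monoʳ-≤ m m≤n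

length-two-colours : (cs : List (Fin 2)) →
  length (filter (_≟ zero) cs) + length (filter (_≟ suc zero) cs) ≡ length cs
length-two-colours []              = refl
length-two-colours (zero ∷ cs)     = cong suc (length-two-colours cs)
length-two-colours (suc zero ∷ cs) = trans (+-suc _ _) (cong suc (length-two-colours cs))

-- The two colour counts add up to `length cs`, so the smaller one is at most half of it.
minority : (cs : List (Fin 2)) → Σ (Fin 2) λ c → 2 * length (filter (_≟ c) cs) ≤ length cs
minority cs with ≤-total (length (filter (_≟ zero) cs)) (length (filter (_≟ suc zero) cs))
... | inj₁ z≤o = zero , m+n≡o∧m≤n⇒2m≤o (length-two-colours cs) z≤o
... | inj₂ o≤z = suc zero ,
  m+n≡o∧m≤n⇒2m≤o (trans (+-comm (length (filter (_≟ suc zero) cs)) _) (length-two-colours cs)) o≤z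

module _ {P : Pred A p} where

  -- Supplies the extensionality of the recursion step that unfolding a well-founded recursion
  -- requires.
  reduce-cong : {f g : ∀ {x} → P x → B} → (∀ {x} (px : P x) → f px ≡ g px) →
                ∀ {xs} (pxs : All P xs) → All.reduce f pxs ≡ All.reduce g pxs
  reduce-cong f≗g []         = refl
  reduce-cong f≗g (px ∷ pxs) = cong₂ _∷_ (f≗g px) (reduce-cong f≗g pxs)

  reduce-const : (f : A → B) → ∀ {xs} (pxs : All P xs) →
                 All.reduce (λ {x} _ → f x) pxs ≡ map f xs
  reduce-const f []         = refl
  reduce-const f (px ∷ pxs) = cong (f _ ∷_) (reduce-const f pxs)

-- By `N≺`, the colours on `N v` are settled before that of `v`, so a minority colour among them can
-- be chosen for `v`, and no later choice alters the count.
wellFounded⇒majority-2-colouring :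
  {_≺_ : Rel A r} → WellFounded _≺_ →
  (N : A → List A) → (∀ v → All (_≺ v) (N v)) →
  Σ (A → Fin 2) λ f → ∀ v → 2 * length (filter (λ w → f w ≟ f v) (N v)) ≤ length (N v)
wellFounded⇒majority-2-colouring {A = A} {_≺_ = _≺_} wf N N≺ = f , f-majority
  where
  open ≤-Reasoning

  step : ∀ v → WfRec _≺_ (λ _ → Fin 2) v → Fin 2
  -- `rec` accepts a vertex only with a proof that it precedes `v`; reducing over `N≺ v` passes
  -- these proofs along.
  step v rec = proj₁ (minority (All.reduce rec (N≺ v)))

  f : A → Fin 2
  f = All.wfRec wf 0ℓ (λ _ → Fin 2) step

  f-unfold : ∀ v → f v ≡ proj₁ (minority (map f (N v)))
  f-unfold v = trans
    (FixPoint.unfold-wfRec wf (λ _ → Fin 2) step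
      (λ x eq → cong (proj₁ ∘ minority) (reduce-cong eq (N≺ x))))
    (cong (proj₁ ∘ minority) (reduce-const f (N≺ v)))

  f-majority : ∀ v → 2 * length (filter (λ w → f w ≟ f v) (N v)) ≤ length (N v)
  f-majority v = begin
    2 * length (filter (λ w → f w ≟ f v) (N v)) ≡⟨ cong (2 *_) (length-filter-map (_≟ f v) f (N v)) ⟨
    -- `f-unfold` is applied only to the colour compared against; the list `map f (N v)` stays as it
    -- is.
    2 * length (filter (_≟ f v) (map f (N v)))  ≤⟨ subst
      (λ c → 2 * length (filter (_≟ c) (map f (N v))) ≤ length (map f (N v)))
      (sym (f-unfold v)) (proj₂ (minority (map f (N v)))) ⟩
    length (map f (N v))                        ≡⟨ length-map f (N v) ⟩
    length (N v)                                ∎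

theorem1 : (n : ℕ) (G : Digraph n) → Σ (Colouring n 4) (λ f → IsMajorityColouring G f)
theorem1 n G = f , f-majority
  where
  open ≤-Reasoning

  N N↓ N↑ : Fin n → List (Fin n)
  N = outNeighbours G
  N↓ v = filter (_<? v) (N v)
  N↑ v = filter (∁? (_<? v)) (N v)

  N↑-above : ∀ v → All (_> v) (N↑ v)
  N↑-above v = All.zipWith
    -- Failing `w < v` gives only `v ≤ w`; the absence of loops makes it strict.
    (λ (w≮v , vw) → ≤∧≢⇒< (≮⇒≥ w≮v) (λ v≡w → loopless G v≡w vw))
    (all-filter (∁? (_<? v)) (N v) , filter⁺ (∁? (_<? v)) (all-filter (arc? G v) (allFin n)))

  -- `down` colours from the least vertex upwards, `up` from the greatest downwards.
  down = wellFounded⇒majority-2-colouring <-wellFounded N↓ (λ v → all-filter (_<? v) (N v))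
  up   = wellFounded⇒majority-2-colouring >-wellFounded N↑ N↑-above

  f↓ f↑ : Colouring n 2
  f↓ = proj₁ down
  f↑ = proj₁ up

  f : Colouring n 4
  -- `combine` encodes pairs of colours injectively in `Fin (2 * 2)`, which computes to `Fin 4`.
  f v = combine (f↓ v) (f↑ v)

  f-majority : IsMajorityColouring G f
  f-majority v = begin
    2 * length (filter (λ w → f w ≟ f v) (N v))
      -- Equal product colours agree in both coordinates; for each out-neighbour only the coordinate
      -- of its own half is kept.
      ≤⟨ *-monoʳ-≤ 2 (length-filter-split _ (_<? v) same↓? same↑?
           (λ {w} → combine-injectiveˡ (f↓ w) (f↑ w) (f↓ v) (f↑ v))
           (λ {w} → combine-injectiveʳ (f↓ w) (f↑ w) (f↓ v) (f↑ v)) (N v)) ⟩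
    2 * (length (filter same↓? (N↓ v)) + length (filter same↑? (N↑ v)))
      ≡⟨ *-distribˡ-+ 2 (length (filter same↓? (N↓ v))) _ ⟩
    2 * length (filter same↓? (N↓ v)) + 2 * length (filter same↑? (N↑ v))
      ≤⟨ +-mono-≤ (proj₂ down v) (proj₂ up v) ⟩
    length (N↓ v) + length (N↑ v)
      ≡⟨ length-filter-∁ (_<? v) (N v) ⟩
    length (N v) ∎
    where
    same↓? = λ w → f↓ w ≟ f↓ v
    same↑? = λ w → f↑ w ≟ f↑ v
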